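{- The abstract factorial given by $$n!_{a}=\prod_{p}p^{\sum_{m=0}^{\infty}\left\lfloor\frac{n}{p^m(p-1)}\right\rfloor}\qquad(n\ge0),$$ the product being over all primes $p$, has as a primitive the ordered set $X=\{b_i\}_{i\ge1}$ where $b_1=2$ and the remaining $b_n$ are given recursively by $$b_n=\frac{n!_{a}}{\prod_{i=1}^{n-1}b_i^{\lfloor n/i\rfloor}},\qquad n>1,$$ and explicitly as follows: $$b_i=\begin{cases}1, & \text{if } i\ne p^m(p-1)\text{ for every prime } p\text{ and every } m\ge0,\\[4pt] \displaystyle\prod_{p\,:\; i=p^m(p-1)\text{ for some } m\ge0}p, & \text{if } i=p^m(p-1)\text{ for some prime } p\text{ and some } m\ge0,\end{cases}$$ where the product extends over all primes $p$ such that $i$ has a representation $i=p^m(p-1)$ for some integer $m\ge0$.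
   Context: An abstract factorial is a function $!_{a}:\mathbb{N}\to\mathbb{Z}^+$ ($\mathbb{N}=\{0,1,2,\dots\}$) with (1) $0!_{a}=1$; (2) $\frac{n!_{a}}{k!_{a}(n-k)!_{a}}\in\mathbb{Z}^+$ for all $0\le k\le n$; (3) $n!\mid n!_{a}$ for every $n\ge1$. Given a sequence $(b_1,b_2,\dots)$ of positive integers (repetitions allowed), its factorial set (with first element $b_1$) is the sequence $B_0=1$, $B_n=\prod_{i=1}^{n}b_i^{\lfloor n/i\rfloor}$ for $n\ge1$. The ordered set $X=\{b_n\}$ is called a primitive of an abstract factorial $!_{a}$ if the sequence $\{n!_{a}\}_{n\ge0}$ coincides with a factorial set of $X$, i.e. $n!_{a}=B_n$ for all $n\ge0$. -}

module Defs where

open import Data.List.Base using (applyUpTo)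
open import Data.Nat.Base
open import Data.Nat.DivMod using (_/_; m<n⇒m/n≡0)
open import Data.Nat.Divisibility using (_∣_)
open import Data.Nat.ListAction using (sum; product)
open import Data.Nat.Primality using (Prime; prime?; prime⇒nonTrivial)
open import Data.Nat.Properties
open import Data.Product.Base using (Σ-syntax; ∃-syntax; _×_; _,_)
open import Level using (Level)
open import Relation.Binary.PropositionalEquality
open import Relation.Nullary
open import Relation.Nullary.Decidable using (_×-dec_; map′)
open import Relation.Unary using (Pred; Decidable)

private
  variable
    ℓ : Level

-- An infinite sum (product) is given together with an index from which on
-- all its terms are 0 (resp. 1); its value is then the finite sum (product) of
-- the terms before that index.

∑∞ : (f : ℕ → ℕ) (N : ℕ) → .(∀ i → N ≤ i → f i ≡ 0) → ℕ
∑∞ f N _ = sum (applyUpTo f N)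

∏∞ : (f : ℕ → ℕ) (N : ℕ) → .(∀ i → N ≤ i → f i ≡ 1) → ℕ
∏∞ f N _ = product (applyUpTo f N)

extendBy1 : {P : Pred ℕ ℓ} → Decidable P → (∀ i → P i → ℕ) → ℕ → ℕ
extendBy1 P? f i with P? i
... | yes pi = f i pi
... | no  _  = 1

extendBy1-≡1 : {P : Pred ℕ ℓ} (P? : Decidable P) (f : ∀ i → P i → ℕ) →
               ∀ i → (∀ pi → f i pi ≡ 1) → extendBy1 P? f i ≡ 1
extendBy1-≡1 P? f i eq with P? i
... | yes pi = eq pi
... | no  _  = refl

-- The product of f i over all i satisfying P.
∏over : {P : Pred ℕ ℓ} (P? : Decidable P) (f : ∀ i → P i → ℕ) (N : ℕ) →
        .(∀ i → N ≤ i → ∀ pi → f i pi ≡ 1) → ℕ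
∏over P? f N eq =
  ∏∞ (extendBy1 P? f) N (λ i N≤i → extendBy1-≡1 P? f i (eq i N≤i))

-- ∏ f n  is  f 1 * f 2 * ⋯ * f n.  The index is recorded as nonzero so that
-- one can divide by it.
∏ : ((i : ℕ) → .{{NonZero i}} → ℕ) → ℕ → ℕ
∏ f n = product (applyUpTo (λ j → f (suc j)) n)

-- Functions into the positive integers are represented by functions into ℕ
-- together with positivity; the quotient in `integral` is a positive integer
-- precisely when it is an integer, as numerator and denominator are positive.
record IsAbstractFactorial (a : ℕ → ℕ) : Set where
  field
    positive : ∀ n → 0 < a n
    at-zero  : a 0 ≡ 1
    integral : ∀ {n k} → k ≤ n → a k * a (n ∸ k) ∣ a n
    !-∣      : ∀ {n} → 1 ≤ n → n ! ∣ a n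

-- A sequence (b₁, b₂, …) is a function on ℕ whose value at 0 is never used.
factorialSet : (ℕ → ℕ) → ℕ → ℕ
factorialSet b n = ∏ (λ i → b i ^ (n / i)) n

record IsPrimitive (b a : ℕ → ℕ) : Set where
  field
    isAbstractFactorial : IsAbstractFactorial a
    positive            : ∀ i → 1 ≤ i → 0 < b i
    coincides           : ∀ n → a n ≡ factorialSet b n

module _ (p : ℕ) .{{_ : NonTrivial p}} where

  private
    instance
      p≢0 : NonZero p
      p≢0 = nonTrivial⇒nonZero p

    1<p : 1 < p
    1<p = nonTrivial⇒n>1 p

  p∸1≢0 : NonZero (p ∸ 1)
  p∸1≢0 = >-nonZero (m<n⇒0<n∸m 1<p)

  p^m[p∸1]≢0 : ∀ m → NonZero (p ^ m * (p ∸ 1))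
  p^m[p∸1]≢0 m = m*n≢0 (p ^ m) (p ∸ 1) {{m^n≢0 p m}} {{p∸1≢0}}

  m<p^m : ∀ m → m < p ^ m
  m<p^m zero    = s≤s z≤n
  m<p^m (suc m) = ≤-<-trans (m<p^m m) (^-monoʳ-< p 1<p (n<1+n m))

  m<p^m[p∸1] : ∀ m → m < p ^ m * (p ∸ 1)
  m<p^m[p∸1] m = <-≤-trans (m<p^m m) (m≤m*n (p ^ m) (p ∸ 1) {{p∸1≢0}})

  p∸1≤p^m[p∸1] : ∀ m → p ∸ 1 ≤ p ^ m * (p ∸ 1)
  p∸1≤p^m[p∸1] m = m≤n*m (p ∸ 1) (p ^ m) {{m^n≢0 p m}}

  exponentTerm : ℕ → ℕ → ℕ
  exponentTerm n m = (n / (p ^ m * (p ∸ 1))) {{p^m[p∸1]≢0 m}}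

  exponentTerm-≡0 : ∀ n m → n ≤ m → exponentTerm n m ≡ 0
  exponentTerm-≡0 n m n≤m =
    m<n⇒m/n≡0 {{p^m[p∸1]≢0 m}} (≤-<-trans n≤m (m<p^m[p∸1] m))

  exponent : ℕ → ℕ
  exponent n = ∑∞ (exponentTerm n) n (exponentTerm-≡0 n)

  exponent-≡0 : ∀ n → 2 + n ≤ p → exponent n ≡ 0
  exponent-≡0 n 2+n≤p = sum-0 n (exponentTerm n) λ m →
    m<n⇒m/n≡0 {{p^m[p∸1]≢0 m}} (≤-trans (∸-monoˡ-≤ 1 2+n≤p) (p∸1≤p^m[p∸1] m))
    where
    sum-0 : ∀ k (f : ℕ → ℕ) → (∀ i → f i ≡ 0) → sum (applyUpTo f k) ≡ 0
    sum-0 zero    f f≡0 = refl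
    sum-0 (suc k) f f≡0 = cong₂ _+_ (f≡0 0) (sum-0 k (λ i → f (suc i)) (λ i → f≡0 (suc i)))

factorialₐ : ℕ → ℕ
factorialₐ n =
  ∏over prime? (λ p pp → p ^ exponent p {{prime⇒nonTrivial pp}} n) (2 + n)
    (λ p 2+n≤p pp → cong (p ^_) (exponent-≡0 p {{prime⇒nonTrivial pp}} n 2+n≤p))

-- i = pᵐ (p - 1) for some m ≥ 0, with p prime
_RepresentedBy_ : ℕ → ℕ → Set
i RepresentedBy p = Prime p × ∃[ m ] i ≡ p ^ m * (p ∸ 1)

representedBy? : ∀ i → Decidable (i RepresentedBy_)
representedBy? i p = map′ to from
  (prime? p ×-dec anyUpTo? (λ m → i ≟ p ^ m * (p ∸ 1)) i)
  where
  to : Prime p × ∃[ m ] (m < i × i ≡ p ^ m * (p ∸ 1)) → i RepresentedBy p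
  to (pp , m , _ , eq) = pp , m , eq
  from : i RepresentedBy p → Prime p × ∃[ m ] (m < i × i ≡ p ^ m * (p ∸ 1))
  from (pp , m , eq) =
    pp , m , subst (m <_) (sym eq) (m<p^m[p∸1] p {{prime⇒nonTrivial pp}} m) , eq

representedBy-< : ∀ {i p} → i RepresentedBy p → p < 2 + i
representedBy-< {i} {p} (pp , m , eq) = s≤s (begin
  p                     ≤⟨ m≤n+m∸n p 1 ⟩
  suc (p ∸ 1)           ≤⟨ s≤s (p∸1≤p^m[p∸1] p {{prime⇒nonTrivial pp}} m) ⟩
  suc (p ^ m * (p ∸ 1)) ≡⟨ cong suc eq ⟨
  suc i                 ∎)
  where open ≤-Reasoning

representingPrimesProduct : ℕ → ℕ
representingPrimesProduct i =
  ∏over (representedBy? i) (λ p _ → p) (2 + i)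
    (λ p 2+i≤p rep → contradiction (representedBy-< rep) (≤⇒≯ 2+i≤p))

-- The denominator has to be nonzero and to divide a n, so that _/_ is the
-- actual quotient rather than its floor.
record GivenRecursively (b a : ℕ → ℕ) : Set where
  denominator : ℕ → ℕ
  denominator n = ∏ (λ i → b i ^ (n / i)) (n ∸ 1)
  field
    first : b 1 ≡ 2
    next  : ∀ n → 1 < n → Σ[ nz ∈ NonZero (denominator n) ]
              denominator n ∣ a n × b n ≡ (a n / denominator n) {{nz}}

record GivenExplicitly (b : ℕ → ℕ) : Set where
  field
    unrepresented : ∀ i → 1 ≤ i → ¬ (∃[ p ] i RepresentedBy p) → b i ≡ 1
    represented   : ∀ i → 1 ≤ i → ∃[ p ] i RepresentedBy p →
                    b i ≡ representingPrimesProduct i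

{-# OPTIONS --safe #-}
-- Both n!ₐ and the factorial set of b are products of prime powers, and for a
-- prime p the index i = pᵐ(p - 1) contributes p^⌊n/i⌋ to either of them, so that
-- the two double products agree after an exchange of their factors.
-- Integrality is ⌊k/i⌋ + ⌊(n-k)/i⌋ ≤ ⌊n/i⌋, and n! ∣ n!ₐ follows from Legendre's
-- formula, since ⌊n/pᵐ⁺¹⌋ ≤ ⌊n/(pᵐ(p - 1))⌋.
module Submission where

open import Defs
open import Algebra.Properties.CommutativeSemigroup using (interchange; xy∙z≈xz∙y)
open import Data.List.Base using ([]; _∷_; _∷ʳ_; applyUpTo)
open import Data.List.Properties using (applyUpTo-∷ʳ)
open import Data.List.Relation.Unary.All using (All; []; _∷_)
open import Data.Nat.Base
open import Data.Nat.DivMod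
open import Data.Nat.Divisibility
open import Data.Nat.ListAction using (sum; product)
open import Data.Nat.ListAction.Properties using (product-++)
open import Data.Nat.Primality
open import Data.Nat.Primality.Factorisation using (factorise; module PrimeFactorisation)
open import Data.Nat.Properties
open import Data.Product.Base using (Σ-syntax; ∃-syntax; _×_; _,_; proj₁)
open import Function.Base using (_∘_)
open import Level using (Level)
open import Relation.Binary.Definitions using (tri<; tri≈; tri>)
open import Relation.Binary.PropositionalEquality
open import Relation.Nullary
open import Relation.Unary using (Pred; Decidable)

private
  variable
    ℓ : Level
    A B : Set
    P : Pred ℕ ℓ
    f g h : ℕ → ℕ
    k m n : ℕ

-- Finite products

prod : ℕ → (ℕ → ℕ) → ℕ
prod n f = product (applyUpTo f n)

prod-syntax : ℕ → (ℕ → ℕ) → ℕ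
prod-syntax = prod

syntax prod-syntax n (λ i → t) = ∏[ i < n ] t

prod-cong : ∀ n → (∀ i → i < n → f i ≡ g i) → prod n f ≡ prod n g
prod-cong zero    f≡g = refl
prod-cong (suc n) f≡g =
  cong₂ _*_ (f≡g 0 z<s) (prod-cong n λ i i<n → f≡g (suc i) (s<s i<n))

prod-≡1 : ∀ n → (∀ i → i < n → f i ≡ 1) → prod n f ≡ 1
prod-≡1 zero    f≡1 = refl
prod-≡1 (suc n) f≡1 =
  cong₂ _*_ (f≡1 0 z<s) (prod-≡1 n λ i i<n → f≡1 (suc i) (s<s i<n))

prod->0 : ∀ n → (∀ i → 0 < f i) → 0 < prod n f
prod->0 zero    f>0 = z<s
prod->0 (suc n) f>0 = *-mono-≤ (f>0 0) (prod->0 n (f>0 ∘ suc))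

prod-* : ∀ n f g → ∏[ i < n ] (f i * g i) ≡ prod n f * prod n g
prod-* zero    f g = refl
prod-* (suc n) f g = begin
  f 0 * g 0 * ∏[ i < n ] (f (suc i) * g (suc i))
    ≡⟨ cong (f 0 * g 0 *_) (prod-* n (f ∘ suc) (g ∘ suc)) ⟩
  f 0 * g 0 * (prod n (f ∘ suc) * prod n (g ∘ suc))
    ≡⟨ interchange *-commutativeSemigroup (f 0) (g 0) _ _ ⟩
  prod (suc n) f * prod (suc n) g
    ∎
  where open ≡-Reasoning

prod-^ : ∀ n f k → prod n f ^ k ≡ ∏[ i < n ] (f i ^ k)
prod-^ n f zero    = sym (prod-≡1 n λ _ _ → refl)
prod-^ n f (suc k) = begin
  prod n f * prod n f ^ k          ≡⟨ cong (prod n f *_) (prod-^ n f k) ⟩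
  prod n f * ∏[ i < n ] (f i ^ k)  ≡⟨ prod-* n f (λ i → f i ^ k) ⟨
  ∏[ i < n ] (f i ^ suc k)         ∎
  where open ≡-Reasoning

prod-swap : ∀ m n (f : ℕ → ℕ → ℕ) →
            ∏[ i < m ] ∏[ j < n ] f i j ≡ ∏[ j < n ] ∏[ i < m ] f i j
prod-swap zero    n f = sym (prod-≡1 n λ _ _ → refl)
prod-swap (suc m) n f = begin
  prod n (f 0) * ∏[ i < m ] ∏[ j < n ] f (suc i) j
    ≡⟨ cong (prod n (f 0) *_) (prod-swap m n (f ∘ suc)) ⟩
  prod n (f 0) * ∏[ j < n ] ∏[ i < m ] f (suc i) j
    ≡⟨ prod-* n (f 0) (λ j → ∏[ i < m ] f (suc i) j) ⟨
  ∏[ j < n ] ∏[ i < suc m ] f i j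
    ∎
  where open ≡-Reasoning

prod-suc : ∀ n f → prod (suc n) f ≡ prod n f * f n
prod-suc n f = begin
  prod (suc n) f                              ≡⟨ cong product (applyUpTo-∷ʳ f n) ⟨
  product (applyUpTo f n ∷ʳ f n)              ≡⟨ product-++ (applyUpTo f n) _ ⟩
  prod n f * (f n * 1)                        ≡⟨ cong (prod n f *_) (*-identityʳ (f n)) ⟩
  prod n f * f n                              ∎
  where open ≡-Reasoning

prod-extend : m ≤ n → (∀ i → m ≤ i → f i ≡ 1) → prod n f ≡ prod m f
prod-extend {n = n} z≤n       f≡1 = prod-≡1 n λ i _ → f≡1 i z≤n
prod-extend {f = f} (s≤s m≤n) f≡1 =
  cong (f 0 *_) (prod-extend m≤n λ i m≤i → f≡1 (suc i) (s≤s m≤i))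

prod-single : ∀ n → k < n → (∀ i → i ≢ k → f i ≡ 1) → prod n f ≡ f k
prod-single {zero}  {f} (suc n) _         f≡1 = begin
  f 0 * prod n (f ∘ suc) ≡⟨ cong (f 0 *_) (prod-≡1 n λ i _ → f≡1 (suc i) λ ()) ⟩
  f 0 * 1                ≡⟨ *-identityʳ (f 0) ⟩
  f 0                    ∎
  where open ≡-Reasoning
prod-single {suc k} {f} (suc n) (s≤s k<n) f≡1 = begin
  f 0 * prod n (f ∘ suc) ≡⟨ cong₂ _*_ (f≡1 0 λ ())
                              (prod-single n k<n λ i i≢k →
                                f≡1 (suc i) (i≢k ∘ suc-injective)) ⟩
  1 * f (suc k)          ≡⟨ *-identityˡ (f (suc k)) ⟩
  f (suc k)              ∎
  where open ≡-Reasoning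

prod-∣ : ∀ n → (∀ i → f i ∣ g i) → prod n f ∣ prod n g
prod-∣ zero    f∣g = ∣-refl
prod-∣ (suc n) f∣g = *-pres-∣ (f∣g 0) (prod-∣ n (f∣g ∘ suc))

prod-*-∣ : ∀ n → (∀ i → f i * g i ∣ h i) → prod n f * prod n g ∣ prod n h
prod-*-∣ {f} {g} {h} n fg∣h =
  subst (_∣ prod n h) (prod-* n f g) (prod-∣ n fg∣h)

-- A single factor with `c` to spare lets the whole product absorb `c`. This is how one more prime
-- is inserted at its own index.
prod-∣-gain : ∀ n c → k < n → (∀ i → f i ∣ g i) → f k * c ∣ g k →
              prod n f * c ∣ prod n g
prod-∣-gain {zero}  {f} {g} (suc n) c _         f∣g fc∣g =
  subst (_∣ prod (suc n) g) (xy∙z≈xz∙y *-commutativeSemigroup (f 0) c _)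
    (*-pres-∣ fc∣g (prod-∣ n (f∣g ∘ suc)))
prod-∣-gain {suc k} {f} {g} (suc n) c (s≤s k<n) f∣g fc∣g =
  subst (_∣ prod (suc n) g) (sym (*-assoc (f 0) _ c))
    (*-pres-∣ (f∣g 0) (prod-∣-gain n c k<n (f∣g ∘ suc) fc∣g))

^-sum : ∀ p n f → p ^ sum (applyUpTo f n) ≡ ∏[ i < n ] (p ^ f i)
^-sum p zero    f = refl
^-sum p (suc n) f = begin
  p ^ (f 0 + sum (applyUpTo (f ∘ suc) n))     ≡⟨ ^-distribˡ-+-* p (f 0) _ ⟩
  p ^ f 0 * p ^ sum (applyUpTo (f ∘ suc) n)   ≡⟨ cong (p ^ f 0 *_) (^-sum p n (f ∘ suc)) ⟩
  p ^ f 0 * ∏[ i < n ] (p ^ f (suc i))        ∎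
  where open ≡-Reasoning

-- Conditional factors

-- The power of `x` whose exponent is the Iverson bracket of `A`.
_when_ : ℕ → Dec A → ℕ
x when yes _ = x
x when no  _ = 1

when-yes : ∀ {x} (A? : Dec A) → A → x when A? ≡ x
when-yes (yes _) a = refl
when-yes (no ¬a) a = contradiction a ¬a

when-no : ∀ {x} (A? : Dec A) → ¬ A → x when A? ≡ 1
when-no (yes a) ¬a = contradiction a ¬a
when-no (no _)  ¬a = refl

when-∣ : ∀ {x} (A? : Dec A) (B? : Dec B) → (A → B) → x when A? ∣ x when B?
when-∣ (no _)  _       A⇒B = 1∣ _
when-∣ (yes _) (yes _) A⇒B = ∣-refl
when-∣ (yes a) (no ¬b) A⇒B = contradiction (A⇒B a) ¬b

extendBy1-cases : (P? : Decidable P) (f : ∀ i → P i → ℕ) → ∀ i {x} →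
                  (∀ pi → f i pi ≡ x) → (¬ P i → 1 ≡ x) → extendBy1 P? f i ≡ x
extendBy1-cases P? f i f≡x 1≡x with P? i
... | yes pi = f≡x pi
... | no ¬pi = 1≡x ¬pi

extendBy1-yes : (P? : Decidable P) (f : ℕ → ℕ) → ∀ {i} → P i →
                extendBy1 P? (λ j _ → f j) i ≡ f i
extendBy1-yes P? f {i} pi =
  extendBy1-cases P? (λ j _ → f j) i (λ _ → refl) λ ¬pi → contradiction pi ¬pi

extendBy1-no : (P? : Decidable P) (f : ∀ i → P i → ℕ) → ∀ {i} → ¬ P i →
               extendBy1 P? f i ≡ 1
extendBy1-no P? f {i} ¬pi =
  extendBy1-cases P? f i (λ pi → contradiction pi ¬pi) λ _ → refl

extendBy1->0 : (P? : Decidable P) (f : ∀ i → P i → ℕ) → ∀ i →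
               (∀ pi → 0 < f i pi) → 0 < extendBy1 P? f i
extendBy1->0 P? f i f>0 with P? i
... | yes pi = f>0 pi
... | no  _  = z<s

extendBy1-∣ : (P? : Decidable P) {f g : ∀ i → P i → ℕ} → ∀ i →
              (∀ pi → f i pi ∣ g i pi) → extendBy1 P? f i ∣ extendBy1 P? g i
extendBy1-∣ P? i f∣g with P? i
... | yes pi = f∣g pi
... | no  _  = ∣-refl

extendBy1-*-∣ : (P? : Decidable P) {f g h : ∀ i → P i → ℕ} → ∀ i →
                (∀ pi → f i pi * g i pi ∣ h i pi) →
                extendBy1 P? f i * extendBy1 P? g i ∣ extendBy1 P? h i
extendBy1-*-∣ P? i fg∣h with P? i
... | yes pi = fg∣h pi
... | no  _  = ∣-refl

-- Powers and floors

^-monoʳ-∣ : ∀ x → m ≤ n → x ^ m ∣ x ^ n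
^-monoʳ-∣ {m} {n} x m≤n = subst (x ^ m ∣_)
  (trans (sym (^-distribˡ-+-* x m (n ∸ m))) (cong (x ^_) (m+[n∸m]≡n m≤n)))
  (m∣m*n (x ^ (n ∸ m)))

^-injectiveʳ : ∀ x → 1 < x → x ^ m ≡ x ^ n → m ≡ n
^-injectiveʳ {m} {n} x 1<x eq with <-cmp m n
... | tri< m<n _ _ = contradiction eq (<⇒≢ (^-monoʳ-< x 1<x m<n))
... | tri≈ _ m≡n _ = m≡n
... | tri> _ _ n<m = contradiction (sym eq) (<⇒≢ (^-monoʳ-< x 1<x n<m))

-- Once `m` is rounded down to the multiple `m / d * d`, division distributes over the sum exactly;
-- undoing the rounding can only raise the quotient.
m/d+n/d≤[m+n]/d : ∀ m n d .{{_ : NonZero d}} → m / d + n / d ≤ (m + n) / d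
m/d+n/d≤[m+n]/d m n d = begin
  m / d + n / d          ≡⟨ cong (_+ n / d) (m*n/n≡m (m / d) d) ⟨
  m / d * d / d + n / d  ≡⟨ +-distrib-/-∣ˡ n (n∣m*n (m / d)) ⟨
  (m / d * d + n) / d    ≤⟨ /-monoˡ-≤ d (+-monoˡ-≤ n (m/n*n≤m m d)) ⟩
  (m + n) / d            ∎
  where open ≤-Reasoning

-- The floor never drops from `n` to `suc n`, and it rises when `d` divides `suc n`, which pays for
-- one extra `p`. With `d` a power of `p` this is the induction step of Legendre's formula.
^[n/d]-step : ∀ p n d .{{_ : NonZero d}} →
              (p when (d ∣? suc n)) * p ^ (n / d) ∣ p ^ (suc n / d)
^[n/d]-step p n d with d ∣? suc n
... | no _ = subst (_∣ p ^ (suc n / d)) (sym (*-identityˡ _))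
  (^-monoʳ-∣ p (/-monoˡ-≤ d (n≤1+n n)))
... | yes (divides q eq) = ^-monoʳ-∣ p (begin
  -- The equation `suc n ≡ q * d` is read as `n < q * d`.
  suc (n / d)  ≤⟨ m<n*o⇒m/o<n (≤-reflexive eq) ⟩
  q            ≡⟨ m*n/n≡m q d ⟨
  q * d / d    ≡⟨ cong (_/ d) eq ⟨
  suc n / d    ∎)
  where open ≤-Reasoning

-- Legendre's formula

-- For N ≥ n ≥ 1 and p prime this is the highest power of p dividing n.
primePowerPart : ℕ → ℕ → ℕ → ℕ
primePowerPart N n p = ∏[ m < N ] (p when (p ^ suc m ∣? n))

-- The bounds `M` on the primes and `N` on the exponents are kept apart from `n`, so that products
-- for different `n` can be compared factor by factor.
primePowerProduct : ℕ → ℕ → ℕ → ℕ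
primePowerProduct M N n = prod M (extendBy1 prime? (λ p _ → primePowerPart N n p))

-- Induction on the list of prime factors: restoring a removed prime `q` shrinks no prime power
-- part, and the part at `q` gains a factor `q`.
∣-primePowerProduct : ∀ {M N} ps → All Prime ps → product ps ≤ N → product ps < M →
                      product ps ∣ primePowerProduct M N (product ps)
∣-primePowerProduct         []       []         _   _   = 1∣ _
∣-primePowerProduct {M} {N} (q ∷ ps) (pq ∷ pps) n≤N n<M = go N n≤N
  where
  n′ = product ps

  instance
    n′≢0 : NonZero n′
    n′≢0 = >-nonZero (productOfPrimes≥1 pps)
    q≢0 : NonZero q
    q≢0 = prime⇒nonZero pq

  n′<n : n′ < q * n′
  n′<n = subst (n′ <_) (*-comm n′ q)
    (m<m*n n′ q (nonTrivial⇒n>1 q {{prime⇒nonTrivial pq}}))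

  grows : ∀ N p → primePowerPart N n′ p ∣ primePowerPart (suc N) (q * n′) p
  grows N p = ∣-trans
    (prod-∣ N λ m → when-∣ (p ^ suc m ∣? n′) (p ^ suc m ∣? q * n′) (∣n⇒∣m*n q))
    (subst (prod N factor ∣_) (sym (prod-suc N factor)) (m∣m*n (factor N)))
    where
    factor : ℕ → ℕ
    factor m = p when (p ^ suc m ∣? q * n′)

  -- Multiplication by `q` shifts the powers of `q` dividing `n′` up by one place, and the vacated
  -- lowest place is filled because `q` itself divides `q * n′`.
  gains-q : ∀ N → primePowerPart N n′ q * q ∣ primePowerPart (suc N) (q * n′) q
  gains-q N = subst₂ _∣_ (*-comm q _)
    (cong (_* ∏[ m < N ] (q when (q ^ suc (suc m) ∣? q * n′)))
      (sym (when-yes (q ^ 1 ∣? q * n′)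
        (subst (_∣ q * n′) (sym (*-identityʳ q)) (m∣m*n n′)))))
    (*-monoʳ-∣ q (prod-∣ N λ m →
      when-∣ (q ^ suc m ∣? n′) (q ^ suc (suc m) ∣? q * n′) (*-monoʳ-∣ q)))

  go : ∀ N → q * n′ ≤ N → q * n′ ∣ primePowerProduct M N (q * n′)
  go zero    n≤0  = contradiction (≤-trans n′<n n≤0) λ ()
  go (suc N) n≤1+N = subst (_∣ primePowerProduct M (suc N) (q * n′)) (*-comm n′ q) (∣-trans
    (*-monoˡ-∣ q (∣-primePowerProduct ps pps
      -- Since `n′ < q * n′`, the exponent bound can be lowered by one along with the removal of
      -- `q`.
      (s≤s⁻¹ (≤-trans n′<n n≤1+N)) (<-trans n′<n n<M)))
    (prod-∣-gain {g = extendBy1 prime? (λ p _ → primePowerPart (suc N) (q * n′) p)}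
      M q (≤-<-trans (m≤m*n q n′) n<M)
      (λ p → extendBy1-∣ prime?
        {λ p _ → primePowerPart N n′ p} {λ p _ → primePowerPart (suc N) (q * n′) p}
        p λ _ → grows N p)
      (subst₂ (λ x y → x * q ∣ y)
        (sym (extendBy1-yes prime? (primePowerPart N n′) pq))
        (sym (extendBy1-yes prime? (primePowerPart (suc N) (q * n′)) pq))
        (gains-q N))))

-- For `n ≤ N` this is the exact power of `p` in `n !`, by Legendre's formula.
legendrePower : ℕ → ℕ → ∀ p → Prime p → ℕ
legendrePower N n p pp = ∏[ m < N ] (p ^ (n / p ^ suc m) {{p^≢0 m}})
  where
  p^≢0 : ∀ m → NonZero (p ^ suc m)
  p^≢0 m = m^n≢0 p (suc m) {{prime⇒nonZero pp}}

-- The new factor `suc n` of the factorial is spread over its prime powers; each contribution is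
-- absorbed by the rise of one floor, as in `^[n/d]-step`.
!-∣-legendre : ∀ {M N} n → n ≤ N → n < M →
               n ! ∣ prod M (extendBy1 prime? (legendrePower N n))
!-∣-legendre         zero    _   _   = 1∣ _
!-∣-legendre {M} {N} (suc n) n<N n<M = ∣-trans
  (*-pres-∣ 1+n∣ (!-∣-legendre n (<⇒≤ n<N) (<-trans (n<1+n n) n<M)))
  (prod-*-∣ M λ p → extendBy1-*-∣ prime? p λ pp → prod-*-∣ N λ m →
    ^[n/d]-step p n (p ^ suc m) {{m^n≢0 p (suc m) {{prime⇒nonZero pp}}}})
  where
  open PrimeFactorisation (factorise (suc n))
  1+n∣ : suc n ∣ primePowerProduct M N (suc n)
  1+n∣ = subst (λ x → x ∣ primePowerProduct M N x) (sym isFactorisation)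
    (∣-primePowerProduct factors factorsPrime
      (subst (_≤ N) isFactorisation n<N) (subst (_< M) isFactorisation n<M))

exponentPower : ℕ → ∀ p → Prime p → ℕ
exponentPower n p pp = p ^ exponent p {{prime⇒nonTrivial pp}} n

!-∣-factorialₐ : ∀ n → n ! ∣ factorialₐ n
-- The bounds `2 + n` and `n` are those in `factorialₐ` and `exponent`, so both double products have
-- the same index ranges.
!-∣-factorialₐ n = ∣-trans (!-∣-legendre n ≤-refl (s≤s (n≤1+n n)))
  (prod-∣ {extendBy1 prime? (legendrePower n n)} {extendBy1 prime? (exponentPower n)}
    (2 + n) λ p → extendBy1-∣ prime? p (legendre∣ p))
  where
  legendre∣ : ∀ p pp → legendrePower n n p pp ∣ exponentPower n p pp
  legendre∣ p pp = subst (legendrePower n n p pp ∣_) (sym (^-sum p n _))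
    (prod-∣ n λ m → ^-monoʳ-∣ p (/-monoʳ-≤ n
      {{m^n≢0 p (suc m) {{prime⇒nonZero pp}}}}
      {{p^m[p∸1]≢0 p {{prime⇒nonTrivial pp}} m}}
      (subst (p ^ m * (p ∸ 1) ≤_) (*-comm (p ^ m) p) (*-monoʳ-≤ (p ^ m) (m∸n≤m p 1)))))

-- Comparison with the factorial set

-- The explicit formula serves as the definition, the empty product giving 1 at unrepresented
-- indices; the recursion is derived from it.
b : ℕ → ℕ
b = representingPrimesProduct

representedFactor : ℕ → ℕ → ℕ
representedFactor i = extendBy1 (representedBy? i) (λ p _ → p)

-- Gives every `b i` with `i ≤ n` the common range `2 + n`, so that products over primes and over
-- indices can be exchanged.
b≡prod : ∀ {i N} → 2 + i ≤ N → b i ≡ prod N (representedFactor i)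
b≡prod {i} 2+i≤N = sym (prod-extend 2+i≤N λ p 2+i≤p →
  extendBy1-no (representedBy? i) (λ p _ → p) λ rep →
    contradiction (representedBy-< rep) (≤⇒≯ 2+i≤p))

-- Ensures that a prime represents an index in at most one way, hence enters `b i` only once.
p^m[p∸1]-injective : ∀ {p} → Prime p → p ^ m * (p ∸ 1) ≡ p ^ n * (p ∸ 1) → m ≡ n
p^m[p∸1]-injective {m} {n} {p} pp eq =
  ^-injectiveʳ p (nonTrivial⇒n>1 p)
    (*-cancelʳ-≡ (p ^ m) (p ^ n) (p ∸ 1) {{p∸1≢0 p}} eq)
  where instance _ = prime⇒nonTrivial pp

module _ (n : ℕ) {p : ℕ} (pp : Prime p) where

  private
    instance
      p-nonTrivial : NonTrivial p
      p-nonTrivial = prime⇒nonTrivial pp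

    e : ℕ → ℕ
    e m = p ^ m * (p ∸ 1)

    -- A square table with exponents `m` as rows and indices `suc j` as columns; multiplying it by
    -- rows or by columns gives the two sides of `p^exponent`.
    factor : ℕ → ℕ → ℕ
    factor m j = (p ^ (n / suc j)) when (suc j ≟ e m)

    ^exponentTerm : ∀ i m → i ≡ e m → .{{_ : NonZero i}} →
                    p ^ exponentTerm p n m ≡ p ^ (n / i)
    ^exponentTerm i m i≡e = cong (p ^_) (/-congʳ {{p^m[p∸1]≢0 p m}} (sym i≡e))

    -- Row `m` can differ from 1 only at the index `e m`. If `e m` exceeds `n`, it falls outside the
    -- table, and the floor is 0 as well.
    collect-j : ∀ m → prod n (factor m) ≡ p ^ exponentTerm p n m
    collect-j m with e m ≤? n
    ... | no e≰n = begin
      prod n (factor m)       ≡⟨ prod-≡1 n (λ j j<n → when-no (suc j ≟ e m) λ eq →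
                                   e≰n (subst (_≤ n) eq j<n)) ⟩
      1                       ≡⟨ cong (p ^_) (m<n⇒m/n≡0 {{p^m[p∸1]≢0 p m}} (≰⇒> e≰n)) ⟨
      p ^ exponentTerm p n m  ∎
      where open ≡-Reasoning
    ... | yes e≤n = begin
      prod n (factor m)       ≡⟨ prod-single n j₀<n (λ j j≢j₀ → when-no (suc j ≟ e m) λ eq →
                                   j≢j₀ (suc-injective (trans eq (sym 1+j₀≡e)))) ⟩
      factor m j₀             ≡⟨ when-yes (suc j₀ ≟ e m) 1+j₀≡e ⟩
      p ^ (n / suc j₀)        ≡⟨ ^exponentTerm (suc j₀) m 1+j₀≡e ⟨
      p ^ exponentTerm p n m  ∎
      where
      open ≡-Reasoning
      j₀ = pred (e m)
      1+j₀≡e : suc j₀ ≡ e m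
      1+j₀≡e = suc-pred (e m) {{p^m[p∸1]≢0 p m}}
      j₀<n : j₀ < n
      j₀<n = subst (_≤ n) (sym 1+j₀≡e) e≤n

    -- By injectivity a column has at most one entry other than 1; its row lies in the table because
    -- `m < e m` and `e m` is the index `suc j`, at most `n`.
    collect-m : ∀ j → j < n →
                ∏[ m < n ] factor m j ≡ representedFactor (suc j) p ^ (n / suc j)
    collect-m j j<n with representedBy? (suc j) p
    ... | no ¬rep = trans
      (prod-≡1 n λ m _ → when-no (suc j ≟ e m) λ eq → ¬rep (pp , m , eq))
      (sym (^-zeroˡ (n / suc j)))
    ... | yes (_ , m , 1+j≡e) = trans
      (prod-single n m<n λ m′ m′≢m → when-no (suc j ≟ e m′) λ eq →
        m′≢m (p^m[p∸1]-injective pp (trans (sym eq) 1+j≡e)))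
      (when-yes (suc j ≟ e m) 1+j≡e)
      where
      m<n : m < n
      m<n = <-≤-trans (m<p^m[p∸1] p m) (subst (_≤ n) 1+j≡e j<n)

  p^exponent : p ^ exponent p n ≡ ∏[ j < n ] (representedFactor (suc j) p ^ (n / suc j))
  p^exponent = begin
    p ^ exponent p n                     ≡⟨ ^-sum p n (exponentTerm p n) ⟩
    ∏[ m < n ] (p ^ exponentTerm p n m)  ≡⟨ prod-cong n (λ m _ → collect-j m) ⟨
    ∏[ m < n ] ∏[ j < n ] factor m j     ≡⟨ prod-swap n n factor ⟩
    ∏[ j < n ] ∏[ m < n ] factor m j     ≡⟨ prod-cong n collect-m ⟩
    ∏[ j < n ] (representedFactor (suc j) p ^ (n / suc j)) ∎
    where open ≡-Reasoning

factorialₐ≡factorialSet : ∀ n → factorialₐ n ≡ factorialSet b n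
factorialₐ≡factorialSet n = begin
  factorialₐ n
    ≡⟨ prod-cong (2 + n) (λ p _ → primePart p) ⟩
  ∏[ p < 2 + n ] ∏[ j < n ] (representedFactor (suc j) p ^ (n / suc j))
    ≡⟨ prod-swap (2 + n) n (λ p j → representedFactor (suc j) p ^ (n / suc j)) ⟩
  ∏[ j < n ] ∏[ p < 2 + n ] (representedFactor (suc j) p ^ (n / suc j))
    ≡⟨ prod-cong n (λ j _ → prod-^ (2 + n) (representedFactor (suc j)) (n / suc j)) ⟨
  ∏[ j < n ] (prod (2 + n) (representedFactor (suc j)) ^ (n / suc j))
    ≡⟨ prod-cong n (λ j j<n → cong (_^ (n / suc j)) (b≡prod (s≤s (s≤s j<n)))) ⟨
  factorialSet b n
    ∎
  where
  open ≡-Reasoning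
  primePart : ∀ p → extendBy1 prime? (exponentPower n) p
                    ≡ ∏[ j < n ] (representedFactor (suc j) p ^ (n / suc j))
  primePart p = extendBy1-cases prime? (exponentPower n) p
    (λ pp → p^exponent n pp)
    -- A number that is not prime represents no index, so its factors on the right are all 1 too.
    (λ ¬pp → sym (prod-≡1 n λ j _ → trans
      (cong (_^ (n / suc j))
        (extendBy1-no (representedBy? (suc j)) (λ p _ → p) (¬pp ∘ proj₁)))
      (^-zeroˡ (n / suc j))))

-- The axioms of an abstract factorial

factorialSet-integral : ∀ c → k ≤ n →
                        factorialSet c k * factorialSet c (n ∸ k) ∣ factorialSet c n
factorialSet-integral {k} {n} c k≤n =
  -- Beyond `k` or `n ∸ k` the quotients vanish, so all three products can run up to `n` and be
  -- compared factor by factor.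
  subst₂ (λ x y → x * y ∣ factorialSet c n) (extend k≤n) (extend (m∸n≤m n k))
    (prod-*-∣ n λ j → subst (_∣ c (suc j) ^ (n / suc j))
      (^-distribˡ-+-* (c (suc j)) (k / suc j) ((n ∸ k) / suc j))
      (^-monoʳ-∣ (c (suc j)) (subst (λ x → k / suc j + (n ∸ k) / suc j ≤ x / suc j)
        (m+[n∸m]≡n k≤n) (m/d+n/d≤[m+n]/d k (n ∸ k) (suc j)))))
  where
  extend : ∀ {l} → l ≤ n → ∏[ j < n ] (c (suc j) ^ (l / suc j)) ≡ factorialSet c l
  extend l≤n = prod-extend l≤n λ j l≤j →
    cong (c (suc j) ^_) (m<n⇒m/n≡0 (s≤s l≤j))

b>0 : ∀ i → 0 < b i
b>0 i = prod->0 (2 + i) λ p → extendBy1->0 (representedBy? i) (λ p _ → p) p λ (pp , _) →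
  >-nonZero⁻¹ p {{prime⇒nonZero pp}}

b^>0 : ∀ i k → 0 < b i ^ k
b^>0 i k = m^n>0 (b i) {{>-nonZero (b>0 i)}} k

factorialₐ-isAbstractFactorial : IsAbstractFactorial factorialₐ
factorialₐ-isAbstractFactorial = record
  { positive = λ n → subst (0 <_) (sym (factorialₐ≡factorialSet n))
      (prod->0 n λ j → b^>0 (suc j) (n / suc j))
  -- Only 0 and 1 lie below the bound 2, and neither is prime.
  ; at-zero  = refl
  ; integral = λ {n} {k} k≤n → subst₂ _∣_
      (sym (cong₂ _*_ (factorialₐ≡factorialSet k) (factorialₐ≡factorialSet (n ∸ k))))
      (sym (factorialₐ≡factorialSet n))
      (factorialSet-integral b k≤n)
  ; !-∣      = λ {n} _ → !-∣-factorialₐ n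
  }

-- The recursive and the explicit formula

b-givenRecursively : GivenRecursively b factorialₐ
-- Below the bound 3 only the prime 2 represents 1, with `m` equal to 0, so `b 1` computes to 2.
b-givenRecursively = record { first = refl ; next = next }
  where
  denominator : ℕ → ℕ
  denominator n = ∏ (λ i → b i ^ (n / i)) (n ∸ 1)

  denominator≢0 : ∀ n → NonZero (denominator n)
  denominator≢0 n = >-nonZero (prod->0 (n ∸ 1) λ j → b^>0 (suc j) (n / suc j))

  -- The last factor of the factorial set has exponent `n / n`, which is 1, so it is `b n` itself.
  split : ∀ n → .{{NonZero n}} → factorialₐ n ≡ b n * denominator n
  split n@(suc n-1) = begin
    factorialₐ n                   ≡⟨ factorialₐ≡factorialSet n ⟩
    factorialSet b n               ≡⟨ prod-suc n-1 (λ j → b (suc j) ^ (n / suc j)) ⟩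
    denominator n * b n ^ (n / n)  ≡⟨ cong (λ k → denominator n * b n ^ k) (n/n≡1 n) ⟩
    denominator n * b n ^ 1        ≡⟨ cong (denominator n *_) (*-identityʳ (b n)) ⟩
    denominator n * b n            ≡⟨ *-comm (denominator n) (b n) ⟩
    b n * denominator n            ∎
    where open ≡-Reasoning

  next : ∀ n → 1 < n → Σ[ nz ∈ NonZero (denominator n) ]
         denominator n ∣ factorialₐ n × b n ≡ (factorialₐ n / denominator n) {{nz}}
  next n 1<n = nz , divides (b n) a≡ ,
    sym (trans (cong (λ x → (x / denominator n) {{nz}}) a≡)
               (m*n/n≡m (b n) (denominator n) {{nz}}))
    where
    nz = denominator≢0 n
    a≡ = split n {{>-nonZero (<-trans z<s 1<n)}}

b-givenExplicitly : GivenExplicitly b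
b-givenExplicitly = record
  { unrepresented = λ i _ ¬rep → prod-≡1 (2 + i) λ p _ →
      extendBy1-no (representedBy? i) (λ p _ → p) λ rep → ¬rep (p , rep)
  ; represented   = λ _ _ _ → refl
  }

theorem37 : ∃[ b ] (GivenRecursively b factorialₐ × GivenExplicitly b × IsPrimitive b factorialₐ)
theorem37 = b , b-givenRecursively , b-givenExplicitly , record
  { isAbstractFactorial = factorialₐ-isAbstractFactorial
  ; positive            = λ i _ → b>0 i
  ; coincides           = factorialₐ≡factorialSet
  }
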